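{- Let $n\ge 2$ and let $t_1,\dots,t_n$ be nonnegative integers with $t_1\ge t_2\ge 1$. Then $$P(t_1,t_2,\ldots,t_n)\ge P(t_1+1,t_2-1,t_3,\ldots,t_n).$$
   Context: For pairwise disjoint finite sets $T_1,\dots,T_n$ with $|T_i|=t_i$, a generalized derangement (GD) is a permutation $\sigma$ of $\bigcup_{i=1}^n T_i$ such that $\sigma(a)\notin T_i$ for every $i$ and every $a\in T_i$. $P(t_1,\dots,t_n)$ denotes the number of GDs; it depends only on the sizes $t_i$. -}

module Defs where

open import Data.Nat using (ℕ; zero; suc; _+_)
open import Data.Fin using (Fin; zero; suc)
open import Data.Fin.Properties using (all?; _≟_)
open import Data.List using (List; []; _∷_; length; lookup; replicate; _++_; map; concatMap; filter; upTo)
open import Data.Product using (_×_)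
open import Relation.Binary.PropositionalEquality using (_≡_)
open import Relation.Nullary using (¬_; Dec)
open import Relation.Nullary.Decidable using (_×-dec_; _→-dec_; ¬?)
import Data.Nat as ℕ

-- The sizes t₁,…,tₙ are given as a list.  The underlying set ⋃ Tᵢ is
-- Fin N, N = t₁+…+tₙ, where the elements are laid out block by block:
-- the element at position a belongs to block (label t a).
labels : List ℕ → List ℕ
labels ts = go 0 ts
  where
  go : ℕ → List ℕ → List ℕ
  go i []       = []
  go i (t ∷ ts) = replicate t i ++ go (suc i) ts

Size : List ℕ → ℕ
Size ts = length (labels ts)

block : (ts : List ℕ) → Fin (Size ts) → ℕ
block ts a = lookup (labels ts) a

allFuns : (m k : ℕ) → List (Fin m → Fin k)
allFuns zero    k = (λ ()) ∷ []
allFuns (suc m) k =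
  concatMap (λ f → map (λ x → λ { zero → x ; (suc i) → f i }) (allFin′ k)) (allFuns m k)
  where
  allFin′ : (k : ℕ) → List (Fin k)
  allFin′ zero    = []
  allFin′ (suc k) = zero ∷ map suc (allFin′ k)

-- σ is a permutation of Fin N (injective self-map of a finite set)
-- and σ(a) ∉ T_i whenever a ∈ T_i
IsGD : (ts : List ℕ) → (Fin (Size ts) → Fin (Size ts)) → Set
IsGD ts σ =
  (∀ a b → σ a ≡ σ b → a ≡ b) × (∀ a → ¬ (block ts (σ a) ≡ block ts a))

isGD? : (ts : List ℕ) → (σ : Fin (Size ts) → Fin (Size ts)) → Dec (IsGD ts σ)
isGD? ts σ =
  all? (λ a → all? (λ b → (σ a ≟ σ b) →-dec (a ≟ b)))
  ×-dec all? (λ a → ¬? (block ts (σ a) ℕ.≟ block ts a))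

P : List ℕ → ℕ
P ts = length (filter (isGD? ts) (allFuns (Size ts) (Size ts)))

{-# OPTIONS --safe #-}
module Submission where

-- Call the elements of T₁ ∪ T₂ inner and the others outer.  Choose first the i
-- elements of T₁ sent to T₂ and the j elements of T₂ sent to T₁, with their
-- images; if M_i(a,b) = C(a,i) C(b,i) i! is the number of i-matchings of K_{a,b},
-- this can be done in M_i(t₁,t₂) M_j(t₁,t₂) ways.  The remaining
-- t₁ + t₂ − i − j inner elements have to go to outer ones, while the outer
-- elements do not distinguish T₁ from T₂, so the number W of completions depends
-- only on t₁ + t₂ − i − j:
--   P(t₁,t₂,…) = Σ_{i,j} M_i(t₁,t₂) M_j(t₁,t₂) W(t₁ + t₂ − i − j).
-- The theorem follows from M_i(a+1,b) ≤ M_i(a,b+1) for b ≤ a.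

open import Defs
open import Data.Bool using (Bool; true; false; if_then_else_; not; _∧_)
open import Data.Bool.Properties using (T-≡)
open import Data.Fin using (Fin; zero; suc)
open import Data.Fin.Properties using (_≟_; suc-injective)
open import Data.List using (List; []; _∷_; _++_; map; concatMap; replicate; length; lookup; filter; tabulate; allFin)
open import Data.List.Properties using (map-cong; map-∘; map-++; map-replicate; map-tabulate; tabulate-cong)
open import Data.Nat using (ℕ; zero; suc; pred; _+_; _*_; _∸_; _≤_; _≥_; _≡ᵇ_; z≤n; s≤s)
open import Data.Nat.ListAction using (sum)
open import Data.Nat.ListAction.Properties using (sum-++)
open import Data.Nat.Properties using (+-assoc; +-comm; +-identityʳ; +-suc; +-mono-≤; +-monoʳ-≤; *-mono-≤; *-monoʳ-≤; *-zeroʳ; *-distribˡ-+; +-∸-assoc; 0∸n≡0; ≡ᵇ⇒≡; ≡⇒≡ᵇ; ≤-trans; ≤-reflexive; m≤n⇒m≤1+n; module ≤-Reasoning)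
open import Data.Nat.Tactic.RingSolver using (solve-∀)
open import Data.Product using (_×_; _,_; proj₁; proj₂)
open import Function using (_∘_; id; const; Equivalence)
open import Relation.Binary.PropositionalEquality using (_≡_; _≢_; refl; sym; trans; cong; cong₂; module ≡-Reasoning)
open import Relation.Nullary using (Dec; yes; no; does; contradiction)

private variable
  A B : Set

-- The metavariables below are solved by the auxiliary functions local to `labels`
-- and `allFuns`.  Those functions carry the arguments of the enclosing function as
-- extra parameters; abstracting over these arguments separates the two roles.

mutual
  labelsFrom : List ℕ → ℕ → List ℕ → List ℕ
  labelsFrom = _

  labels-∷ : ∀ t ts → labels (t ∷ ts) ≡ replicate t 0 ++ labelsFrom (t ∷ ts) 1 ts
  labels-∷ t ts with t ∷ ts | 1
  ... | _ | _ = refl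

mutual
  cons : ∀ m k → (Fin m → Fin k) → Fin k → Fin (suc m) → Fin k
  cons = _

  heads : ℕ → (k : ℕ) → List (Fin k)
  heads = _

  allFuns-suc : ∀ m k → allFuns (suc m) k ≡ concatMap (λ f → map (cons m k f) (heads m k)) (allFuns m k)
  allFuns-suc m k = refl

mutual
  sucHeads : ℕ → (k : ℕ) → List (Fin k)
  sucHeads = _

  heads-suc : ∀ m k → heads m (suc k) ≡ zero ∷ map suc (sucHeads m k)
  heads-suc m k = refl

mutual
  finList : ℕ → ℕ → (j : ℕ) → List (Fin j)
  finList = _

  sucHeads-finList : ∀ m k → sucHeads m k ≡ finList m (suc k) k
  sucHeads-finList m k with suc k
  ... | _ = refl

labelsFrom-suc : ∀ us vs i ts → labelsFrom us (suc i) ts ≡ map suc (labelsFrom vs i ts)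
labelsFrom-suc us vs i []       = refl
labelsFrom-suc us vs i (t ∷ ts) =
  trans (cong₂ _++_ (sym (map-replicate suc t i)) (labelsFrom-suc us vs (suc i) ts))
        (sym (map-++ suc (replicate t i) _))

finList-allFin : ∀ m k j → finList m k j ≡ allFin j
finList-allFin m k zero    = refl
finList-allFin m k (suc j) =
  cong (zero ∷_) (trans (cong (map suc) (finList-allFin m k j)) (map-tabulate id suc))

-- Sums over picked elements

-- Entries are picked by position, so equal entries are counted separately.
pick : (A → List A → ℕ) → List A → ℕ
pick f []       = 0
pick f (x ∷ xs) = f x xs + pick (λ y ys → f y (x ∷ ys)) xs

pick-cong : {f g : A → List A → ℕ} → (∀ x xs → f x xs ≡ g x xs) → ∀ xs → pick f xs ≡ pick g xs
pick-cong f≗g []       = refl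
pick-cong f≗g (x ∷ xs) = cong₂ _+_ (f≗g x xs) (pick-cong (λ y ys → f≗g y (x ∷ ys)) xs)

+-interchange : ∀ a b c d → (a + b) + (c + d) ≡ (a + c) + (b + d)
+-interchange = solve-∀

pick-+ : ∀ (f g : A → List A → ℕ) xs → pick (λ x ys → f x ys + g x ys) xs ≡ pick f xs + pick g xs
pick-+ f g []       = refl
pick-+ f g (x ∷ xs) = trans (cong (f x xs + g x xs +_) (pick-+ _ _ xs)) (+-interchange (f x xs) (g x xs) _ _)

pick-* : ∀ n (f : A → List A → ℕ) xs → pick (λ x ys → n * f x ys) xs ≡ n * pick f xs
pick-* n f []       = sym (*-zeroʳ n)
pick-* n f (x ∷ xs) = trans (cong (n * f x xs +_) (pick-* n _ xs)) (sym (*-distribˡ-+ n (f x xs) _))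

pick-++ : ∀ (f : A → List A → ℕ) xs ys →
  pick f (xs ++ ys) ≡ pick (λ x zs → f x (zs ++ ys)) xs + pick (λ y zs → f y (xs ++ zs)) ys
pick-++ f []       ys = refl
pick-++ f (x ∷ xs) ys = trans (cong (f x (xs ++ ys) +_) (pick-++ _ xs ys)) (sym (+-assoc (f x (xs ++ ys)) _ _))

pick-map : ∀ (f : B → List B → ℕ) (g : A → B) xs → pick f (map g xs) ≡ pick (λ x ys → f (g x) (map g ys)) xs
pick-map f g []       = refl
pick-map f g (x ∷ xs) = cong (f (g x) (map g xs) +_) (pick-map _ g xs)

pick-replicate : ∀ (f : A → List A → ℕ) n x → pick f (replicate n x) ≡ n * f x (replicate (pred n) x)
pick-replicate f zero          x = refl
pick-replicate f (suc zero)    x = refl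
pick-replicate f (suc (suc n)) x = cong (f x (replicate (suc n) x) +_) (pick-replicate (λ y ys → f y (x ∷ ys)) (suc n) x)

-- Placements

-- The number of injections from the positions of ss to those of ts that never
-- send a position to one with the same label.
placements : List ℕ → List ℕ → ℕ
placements []       ts = 1
placements (s ∷ ss) ts = pick (λ t us → if t ≡ᵇ s then 0 else placements ss us) ts

-- The free targets are kept as a predicate on a fixed `Fin k`, so the codomain does not change
-- while positions are filled; `labelsOn` turns the predicate into the list on which `placements`
-- recurses.
remove : ∀ {k} → (Fin k → Bool) → Fin k → Fin k → Bool
remove U x y = not (does (x ≟ y)) ∧ U y

labelsOn : ∀ {k} → (Fin k → ℕ) → (Fin k → Bool) → List ℕ
labelsOn {zero}  ℓ U = []
labelsOn {suc k} ℓ U = if U zero then ℓ zero ∷ labelsOn (ℓ ∘ suc) (U ∘ suc) else labelsOn (ℓ ∘ suc) (U ∘ suc)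

labelsOn-lookup : ∀ ls → labelsOn (lookup ls) (const true) ≡ ls
labelsOn-lookup []       = refl
labelsOn-lookup (l ∷ ls) = cong (l ∷_) (labelsOn-lookup ls)

-- If `zero` is free, its label stays at the front of every remainder left by a later pick and is
-- absorbed into `g`.
pick-labelsOn : ∀ {k} (ℓ : Fin k → ℕ) U (g : ℕ → List ℕ → ℕ) →
  sum (tabulate (λ x → if U x then g (ℓ x) (labelsOn ℓ (remove U x)) else 0)) ≡ pick g (labelsOn ℓ U)
pick-labelsOn {zero}  ℓ U g = refl
pick-labelsOn {suc k} ℓ U g with U zero
... | true  = cong (g (ℓ zero) (labelsOn (ℓ ∘ suc) (U ∘ suc)) +_)
                   (pick-labelsOn (ℓ ∘ suc) (U ∘ suc) (λ y ys → g y (ℓ zero ∷ ys)))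
... | false = pick-labelsOn (ℓ ∘ suc) (U ∘ suc) g

𝟙 : Bool → ℕ
𝟙 b = if b then 1 else 0

length-filter : ∀ {Q : A → Set} (Q? : ∀ x → Dec (Q x)) xs → length (filter Q? xs) ≡ sum (map (λ x → 𝟙 (does (Q? x))) xs)
length-filter Q? []       = refl
length-filter Q? (x ∷ xs) with does (Q? x)
... | true  = cong suc (length-filter Q? xs)
... | false = length-filter Q? xs

sum-map-concatMap : ∀ (F : B → ℕ) (g : A → List B) xs → sum (map F (concatMap g xs)) ≡ sum (map (λ x → sum (map F (g x))) xs)
sum-map-concatMap F g []       = refl
sum-map-concatMap F g (x ∷ xs) = begin
  sum (map F (g x ++ concatMap g xs))              ≡⟨ cong sum (map-++ F (g x) _) ⟩
  sum (map F (g x) ++ map F (concatMap g xs))      ≡⟨ sum-++ (map F (g x)) _ ⟩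
  sum (map F (g x)) + sum (map F (concatMap g xs)) ≡⟨ cong (sum (map F (g x)) +_) (sum-map-concatMap F g xs) ⟩
  sum (map (λ y → sum (map F (g y))) (x ∷ xs))     ∎
  where open ≡-Reasoning

sum-map-0 : ∀ (xs : List A) → sum (map (const 0) xs) ≡ 0
sum-map-0 []       = refl
sum-map-0 (x ∷ xs) = sum-map-0 xs

sum-map-+ : ∀ (f g : A → ℕ) xs → sum (map (λ x → f x + g x) xs) ≡ sum (map f xs) + sum (map g xs)
sum-map-+ f g []       = refl
sum-map-+ f g (x ∷ xs) = trans (cong (f x + g x +_) (sum-map-+ f g xs)) (+-interchange (f x) (g x) _ _)

sum-swap : ∀ {k} (F : A → Fin k → ℕ) xs →
  sum (map (λ a → sum (tabulate (F a))) xs) ≡ sum (tabulate (λ x → sum (map (λ a → F a x) xs)))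
sum-swap {k = zero}  F xs = sum-map-0 xs
sum-swap {k = suc k} F xs =
  trans (sum-map-+ (λ a → F a zero) (λ a → sum (tabulate (F a ∘ suc))) xs)
        (cong (sum (map (λ a → F a zero) xs) +_) (sum-swap (λ a → F a ∘ suc) xs))

isPlacement : ∀ {k} → (Fin k → ℕ) → (ss : List ℕ) → (Fin k → Bool) → (Fin (length ss) → Fin k) → Bool
isPlacement ℓ []       U f = true
isPlacement ℓ (s ∷ ss) U f =
  U (f zero) ∧ (not (ℓ (f zero) ≡ᵇ s) ∧ isPlacement ℓ ss (remove U (f zero)) (f ∘ suc))

-- A function is a head value `x` and a tail. With the sum over `x` moved outside, an occupied or
-- forbidden `x` contributes 0; any other leaves the tails to be counted with `x` removed.
count-isPlacement : ∀ {k} (ℓ : Fin k → ℕ) ss U →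
  sum (map (𝟙 ∘ isPlacement ℓ ss U) (allFuns (length ss) k)) ≡ placements ss (labelsOn ℓ U)
count-isPlacement     ℓ []       U = refl
count-isPlacement {k} ℓ (s ∷ ss) U = begin
  sum (map F (concatMap (λ f → map (cons m k f) (heads m k)) fs))
    ≡⟨ sum-map-concatMap F _ fs ⟩
  sum (map (λ f → sum (map F (map (cons m k f) (heads m k)))) fs)
    ≡⟨ cong sum (map-cong (λ f → cong sum (over-heads f)) fs) ⟩
  sum (map (λ f → sum (tabulate (λ x → F (cons m k f x)))) fs)
    ≡⟨ sum-swap (λ f x → F (cons m k f x)) fs ⟩
  sum (tabulate (λ x → sum (map (λ f → F (cons m k f x)) fs)))
    ≡⟨ cong sum (tabulate-cong at-head) ⟩
  sum (tabulate (λ x → if U x then (if ℓ x ≡ᵇ s then 0 else placements ss (labelsOn ℓ (remove U x))) else 0))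
    ≡⟨ pick-labelsOn ℓ U _ ⟩
  placements (s ∷ ss) (labelsOn ℓ U) ∎
  where
  open ≡-Reasoning
  m  = length ss
  fs = allFuns m k
  F  = 𝟙 ∘ isPlacement ℓ (s ∷ ss) U

  over-heads : ∀ f → map F (map (cons m k f) (heads m k)) ≡ tabulate (λ x → F (cons m k f x))
  over-heads f = trans (sym (map-∘ (heads m k)))
    (trans (cong (map (F ∘ cons m k f)) (finList-allFin m k k)) (map-tabulate id _))

  at-head : ∀ x → sum (map (λ f → F (cons m k f x)) fs)
                ≡ (if U x then (if ℓ x ≡ᵇ s then 0 else placements ss (labelsOn ℓ (remove U x))) else 0)
  at-head x with U x | ℓ x ≡ᵇ s | count-isPlacement ℓ ss (remove U x)
  ... | false | _     | _  = sum-map-0 fs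
  ... | true  | true  | _  = sum-map-0 fs
  ... | true  | false | eq = eq

-- The Boolean test and generalized derangements

IsPlacement : ∀ {k} → (Fin k → ℕ) → (ss : List ℕ) → (Fin k → Bool) → (Fin (length ss) → Fin k) → Set
IsPlacement ℓ ss U f =
  (∀ a b → f a ≡ f b → a ≡ b) × (∀ a → U (f a) ≡ true) × (∀ a → ℓ (f a) ≢ lookup ss a)

∧-true : ∀ {a b} → a ∧ b ≡ true → a ≡ true × b ≡ true
∧-true {true} eq = refl , eq

not-≡ᵇ-true : ∀ {m n} → not (m ≡ᵇ n) ≡ true → m ≢ n
not-≡ᵇ-true {m} eq refl with m ≡ᵇ m | Equivalence.to T-≡ (≡⇒≡ᵇ m m refl)
not-≡ᵇ-true ()  refl | true | refl

≢⇒not-≡ᵇ : ∀ {m n} → m ≢ n → not (m ≡ᵇ n) ≡ true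
≢⇒not-≡ᵇ {m} {n} m≢n with m ≡ᵇ n | ≡ᵇ⇒≡ m n
... | true  | eq = contradiction (eq _) m≢n
... | false | _  = refl

remove-true : ∀ {k} (U : Fin k → Bool) x y → remove U x y ≡ true → x ≢ y × U y ≡ true
remove-true U x y eq with x ≟ y
... | no x≢y = x≢y , eq

true-remove : ∀ {k} (U : Fin k → Bool) x y → x ≢ y → U y ≡ true → remove U x y ≡ true
true-remove U x y x≢y eq with x ≟ y
... | yes x≡y = contradiction x≡y x≢y
... | no  _   = eq

-- Injectivity is read off from the removals: later values differ from `f zero` because they are
-- available in `remove U (f zero)`.
isPlacement-sound : ∀ {k} (ℓ : Fin k → ℕ) ss U f → isPlacement ℓ ss U f ≡ true → IsPlacement ℓ ss U f
isPlacement-sound ℓ []       U f eq = (λ ()) , (λ ()) , (λ ())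
isPlacement-sound ℓ (s ∷ ss) U f eq with ∧-true {U (f zero)} eq
... | u₀ , eq₁ with ∧-true {not (ℓ (f zero) ≡ᵇ s)} eq₁
... | l₀ , eq₂ with isPlacement-sound ℓ ss (remove U (f zero)) (f ∘ suc) eq₂
... | inj , avail , ok = inj′ , avail′ , ok′
  where
  removed : ∀ a → f zero ≢ f (suc a) × U (f (suc a)) ≡ true
  removed a = remove-true U (f zero) (f (suc a)) (avail a)

  inj′ : ∀ a b → f a ≡ f b → a ≡ b
  inj′ zero    zero    e = refl
  inj′ zero    (suc b) e = contradiction e (proj₁ (removed b))
  inj′ (suc a) zero    e = contradiction (sym e) (proj₁ (removed a))
  inj′ (suc a) (suc b) e = cong suc (inj a b e)

  avail′ : ∀ a → U (f a) ≡ true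
  avail′ zero    = u₀
  avail′ (suc a) = proj₂ (removed a)

  ok′ : ∀ a → ℓ (f a) ≢ lookup (s ∷ ss) a
  ok′ zero    = not-≡ᵇ-true l₀
  ok′ (suc a) = ok a

isPlacement-complete : ∀ {k} (ℓ : Fin k → ℕ) ss U f → IsPlacement ℓ ss U f → isPlacement ℓ ss U f ≡ true
isPlacement-complete ℓ []       U f _ = refl
isPlacement-complete ℓ (s ∷ ss) U f (inj , avail , ok) =
  cong₂ _∧_ (avail zero) (cong₂ _∧_ (≢⇒not-≡ᵇ (ok zero)) (isPlacement-complete ℓ ss _ (f ∘ suc)
    ( (λ a b e → suc-injective (inj (suc a) (suc b) e))
    , (λ a → true-remove U (f zero) (f (suc a)) (λ e → contradiction (inj zero (suc a) e) λ ()) (avail (suc a)))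
    , (λ a → ok (suc a)))))

does-≡ : ∀ {Q : Set} {b} (Q? : Dec Q) → (Q → b ≡ true) → (b ≡ true → Q) → does Q? ≡ b
does-≡           (yes q) to from = sym (to q)
does-≡ {b = true}  (no ¬q) to from = contradiction (from refl) ¬q
does-≡ {b = false} (no ¬q) to from = refl

P≡placements : ∀ ts → P ts ≡ placements (labels ts) (labels ts)
P≡placements ts = begin
  P ts
    ≡⟨ length-filter (isGD? ts) fs ⟩
  sum (map (λ σ → 𝟙 (does (isGD? ts σ))) fs)
    ≡⟨ cong sum (map-cong (λ σ → cong 𝟙 (does-≡ (isGD? ts σ) (complete σ) (sound σ))) fs) ⟩
  sum (map (𝟙 ∘ isPlacement (block ts) (labels ts) (const true)) fs)
    ≡⟨ count-isPlacement (block ts) (labels ts) (const true) ⟩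
  placements (labels ts) (labelsOn (block ts) (const true))
    ≡⟨ cong (placements (labels ts)) (labelsOn-lookup (labels ts)) ⟩
  placements (labels ts) (labels ts) ∎
  where
  open ≡-Reasoning
  fs = allFuns (Size ts) (Size ts)

  complete : ∀ σ → IsGD ts σ → isPlacement (block ts) (labels ts) (const true) σ ≡ true
  complete σ (inj , ok) = isPlacement-complete (block ts) (labels ts) _ σ (inj , (λ _ → refl) , ok)

  sound : ∀ σ → isPlacement (block ts) (labels ts) (const true) σ ≡ true → IsGD ts σ
  sound σ eq with isPlacement-sound (block ts) (labels ts) _ σ eq
  ... | inj , _ , ok = inj , ok

-- Sums over the matchings of a complete bipartite graph

-- rook a d ψ = Σᵢ C(a,i) C(d,i) i! ψ(i): the sum of ψ(size) over the matchings of
-- K_{a,d}, where the first of the a vertices is either unmatched or has d partners.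
rook : ℕ → ℕ → (ℕ → ℕ) → ℕ
rook zero    d ψ = ψ 0
rook (suc a) d ψ = rook a d ψ + d * rook a (pred d) (ψ ∘ suc)

-- A matching of `K_{a,d}` has at most `min(a,d)` edges. These bounds are what makes truncated
-- subtractions exact later on.
rook-cong : ∀ a d {ψ χ} → (∀ i → i ≤ a → i ≤ d → ψ i ≡ χ i) → rook a d ψ ≡ rook a d χ
rook-cong zero    d       eq = eq 0 z≤n z≤n
rook-cong (suc a) zero    eq = cong (_+ 0) (rook-cong a 0 (λ i _ i≤0 → eq i (≤-trans i≤0 z≤n) i≤0))
rook-cong (suc a) (suc d) eq =
  cong₂ _+_ (rook-cong a (suc d) (λ i i≤a → eq i (m≤n⇒m≤1+n i≤a)))
            (cong (suc d *_) (rook-cong a d (λ i i≤a i≤d → eq (suc i) (s≤s i≤a) (s≤s i≤d))))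

rook-mono : ∀ a d {ψ χ} → (∀ i → ψ i ≤ χ i) → rook a d ψ ≤ rook a d χ
rook-mono zero    d le = le 0
rook-mono (suc a) d le = +-mono-≤ (rook-mono a d le) (*-monoʳ-≤ d (rook-mono a (pred d) (le ∘ suc)))

-- The defining recursion seen from the other side: the extra right vertex is unmatched or has one
-- of `a` partners. After both extra vertices are split off and common terms cancelled, `exchange`
-- remains.
rook-sucʳ : ∀ a d ψ → rook a (suc d) ψ ≡ rook a d ψ + a * rook (pred a) d (ψ ∘ suc)
rook-sucʳ zero    d ψ = sym (+-identityʳ (ψ 0))
rook-sucʳ (suc a) d ψ = begin
  rook a (suc d) ψ + suc d * r                        ≡⟨ cong (_+ suc d * r) (rook-sucʳ a d ψ) ⟩
  rook a d ψ + a * rook (pred a) d ψ′ + suc d * r      ≡⟨ regroup (rook a d ψ) (a * rook (pred a) d ψ′) (d * r) r ⟩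
  rook a d ψ + (a * rook (pred a) d ψ′ + d * r) + r    ≡⟨ cong (λ z → rook a d ψ + z + r) (exchange a d) ⟩
  rook a d ψ + (d * rook a (pred d) ψ′ + a * r) + r    ≡⟨ sym (regroup (rook a d ψ) (d * rook a (pred d) ψ′) (a * r) r) ⟩
  rook a d ψ + d * rook a (pred d) ψ′ + suc a * r      ∎
  where
  open ≡-Reasoning
  ψ′ = ψ ∘ suc
  r  = rook a d ψ′

  regroup : ∀ x y z w → x + y + (w + z) ≡ x + (y + z) + w
  regroup = solve-∀

  mix : ∀ p q v m n → m * p + n * (q + m * v) ≡ n * q + m * (p + n * v)
  mix = solve-∀

  exchange : ∀ a d → a * rook (pred a) d ψ′ + d * rook a d ψ′ ≡ d * rook a (pred d) ψ′ + a * rook a d ψ′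
  exchange zero    d       = sym (+-identityʳ _)
  exchange (suc a) zero    = trans (+-identityʳ _) (cong (suc a *_) (sym (+-identityʳ _)))
  -- The term `rook (suc a) (suc d) ψ′` occurs on both sides; it is expanded at a right vertex on
  -- the left side and, by definition, at a left vertex on the right side.
  exchange (suc a) (suc d) =
    trans (cong (λ z → suc a * rook a (suc d) ψ′ + suc d * z) (rook-sucʳ (suc a) d ψ′))
          (mix (rook a (suc d) ψ′) (rook (suc a) d ψ′) (rook a d (ψ′ ∘ suc)) (suc a) (suc d))

rook-zeroʳ : ∀ a ψ → rook a 0 ψ ≡ ψ 0
rook-zeroʳ zero    ψ = refl
rook-zeroʳ (suc a) ψ = trans (+-identityʳ _) (rook-zeroʳ a ψ)

rook-comm : ∀ a d ψ → rook a d ψ ≡ rook d a ψ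
rook-comm zero    d ψ = sym (rook-zeroʳ d ψ)
rook-comm (suc a) d ψ =
  trans (cong₂ (λ x y → x + d * y) (rook-comm a d ψ) (rook-comm a (pred d) (ψ ∘ suc))) (sym (rook-sucʳ d a ψ))

-- Matchings inside the common `K_{a,b}` cancel. Those using the extra vertex give
-- `b * rook a (b - 1)` against `a * rook (a - 1) b`, which compare by `b ≤ a` and the same
-- inequality for `a - 1`, `b - 1`.
rook-balance : ∀ {a b} ψ → b ≤ a → rook (suc a) b ψ ≤ rook a (suc b) ψ
rook-balance {a} {b} ψ b≤a =
  ≤-trans (+-monoʳ-≤ (rook a b ψ) (step b≤a)) (≤-reflexive (sym (rook-sucʳ a b ψ)))
  where
  step : ∀ {a b} → b ≤ a → b * rook a (pred b) (ψ ∘ suc) ≤ a * rook (pred a) b (ψ ∘ suc)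
  step z≤n       = z≤n
  step (s≤s b≤a) = *-mono-≤ (s≤s b≤a) (rook-balance (ψ ∘ suc) b≤a)

-- Eliminating the first two blocks

-- An inner element may go to every outer one, so the picked label is ignored.
pickAny : (List ℕ → ℕ) → List ℕ → ℕ
pickAny h = pick (λ _ → h)

pickAny^ : ℕ → (List ℕ → ℕ) → List ℕ → ℕ
pickAny^ zero    h = h
pickAny^ (suc n) h = pickAny (pickAny^ n h)

pickAny^-cong : ∀ n {h g} → (∀ r → h r ≡ g r) → ∀ r → pickAny^ n h r ≡ pickAny^ n g r
pickAny^-cong zero    h≗g r = h≗g r
pickAny^-cong (suc n) h≗g r = pick-cong (λ _ → pickAny^-cong n h≗g) r

pickAny^-+ : ∀ m n h → pickAny^ m (pickAny^ n h) ≡ pickAny^ (m + n) h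
pickAny^-+ zero    n h = refl
pickAny^-+ (suc m) n h = cong pickAny (pickAny^-+ m n h)

-- `rook a d` is linear in `ψ`, with coefficients independent of `s`.
pickAny-rook : ∀ a d (ψ : List ℕ → ℕ → ℕ) r →
  pickAny (λ s → rook a d (ψ s)) r ≡ rook a d (λ i → pickAny (λ s → ψ s i) r)
pickAny-rook zero    d ψ r = refl
pickAny-rook (suc a) d ψ r = trans (pick-+ _ _ r)
  (cong₂ _+_ (pickAny-rook a d ψ r)
             (trans (pick-* d _ r) (cong (d *_) (pickAny-rook a (pred d) (λ s → ψ s ∘ suc) r))))

pickAny^-rook : ∀ n a d (ψ : List ℕ → ℕ → ℕ) r →
  pickAny^ n (λ s → rook a d (ψ s)) r ≡ rook a d (λ i → pickAny^ n (λ s → ψ s i) r)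
pickAny^-rook zero    a d ψ r = refl
pickAny^-rook (suc n) a d ψ r =
  trans (pick-cong (λ _ → pickAny^-rook n a d ψ) r) (pickAny-rook a d (λ s i → pickAny^ n (λ s → ψ s i) s) r)

-- Here `a` sources of one inner block face `d` targets of the other and the outer targets `r`. If
-- `i` of them take inner targets, the other `a ∸ i` go outside. It is applied once to each inner
-- block.
rook-expansion : (F : ℕ → ℕ → List ℕ → ℕ) →
  (∀ a d r → F (suc a) d r ≡ pickAny (F a d) r + d * F a (pred d) r) →
  ∀ a d r → F a d r ≡ rook a d (λ i → pickAny^ (a ∸ i) (F 0 (d ∸ i)) r)
rook-expansion F F-suc zero    d r = refl
rook-expansion F F-suc (suc a) d r = trans (F-suc a d r) (cong₂ _+_ unmatched matched)
  where
  open ≡-Reasoning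

  unmatched : pickAny (F a d) r ≡ rook a d (λ i → pickAny^ (suc a ∸ i) (F 0 (d ∸ i)) r)
  unmatched = begin
    pickAny (F a d) r
      ≡⟨ pick-cong (λ _ → rook-expansion F F-suc a d) r ⟩
    pickAny (λ s → rook a d (λ i → pickAny^ (a ∸ i) (F 0 (d ∸ i)) s)) r
      ≡⟨ pickAny-rook a d _ r ⟩
    rook a d (λ i → pickAny^ (suc (a ∸ i)) (F 0 (d ∸ i)) r)
      -- The identity `suc (a ∸ i) ≡ suc a ∸ i` rests on `i ≤ a`.
      ≡⟨ rook-cong a d (λ i i≤a _ → cong (λ n → pickAny^ n (F 0 (d ∸ i)) r) (sym (+-∸-assoc 1 i≤a))) ⟩
    rook a d (λ i → pickAny^ (suc a ∸ i) (F 0 (d ∸ i)) r) ∎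

  pred-∸ : ∀ d i → pred d ∸ i ≡ d ∸ suc i
  pred-∸ zero    i = 0∸n≡0 i
  pred-∸ (suc d) i = refl

  matched : d * F a (pred d) r ≡ d * rook a (pred d) (λ i → pickAny^ (a ∸ i) (F 0 (d ∸ suc i)) r)
  matched = cong (d *_) (trans (rook-expansion F F-suc a (pred d) r)
    (rook-cong a (pred d) (λ i _ _ → cong (λ e → pickAny^ (a ∸ i) (F 0 e) r) (pred-∸ d i))))

-- The shift by 2 lets every comparison of an inner with an outer label compute to `false`.
targets : ℕ → ℕ → List ℕ → List ℕ
targets c d r = replicate c 0 ++ (replicate d 1 ++ map (2 +_) r)

pick-targets : ∀ (f : ℕ → List ℕ → ℕ) c d r → pick f (targets c d r) ≡
  c * f 0 (targets (pred c) d r) + (d * f 1 (targets c (pred d) r) + pick (λ t s → f (2 + t) (targets c d s)) r)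
pick-targets f c d r =
  trans (pick-++ f (replicate c 0) _) (cong₂ _+_ (pick-replicate _ c 0)
    (trans (pick-++ _ (replicate d 1) _) (cong₂ _+_ (pick-replicate _ d 1) (pick-map _ (2 +_) r))))

-- The `c` targets of the source's own block contribute nothing, which leaves the recursion required
-- by `rook-expansion`.
placements-0∷ : ∀ ss c d r → placements (0 ∷ ss) (targets c d r) ≡
  pickAny (λ s → placements ss (targets c d s)) r + d * placements ss (targets c (pred d) r)
placements-0∷ ss c d r =
  trans (pick-targets _ c d r) (trans (cong (_+ (d * inner + outer)) (*-zeroʳ c)) (+-comm (d * inner) outer))
  where
  inner = placements ss (targets c (pred d) r)
  outer = pickAny (λ s → placements ss (targets c d s)) r

placements-1∷ : ∀ ss c d r → placements (1 ∷ ss) (targets c d r) ≡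
  pickAny (λ s → placements ss (targets c d s)) r + c * placements ss (targets (pred c) d r)
placements-1∷ ss c d r =
  trans (pick-targets _ c d r) (trans (cong (λ z → c * inner + (z + outer)) (*-zeroʳ d)) (+-comm (c * inner) outer))
  where
  inner = placements ss (targets (pred c) d r)
  outer = pickAny (λ s → placements ss (targets c d s)) r

-- Sources with labels at least 2 are allowed on labels 0 and 1 alike, so only the total `c + d`
-- counts.
placements-merge : ∀ ss c d r →
  placements (map (2 +_) ss) (targets c d r) ≡ placements (map (2 +_) ss) (targets (c + d) 0 r)
placements-merge []       c d r = refl
placements-merge (s ∷ ss) c d r = begin
  placements (2 + s ∷ ss′) (targets c d r)
    ≡⟨ pick-targets _ c d r ⟩
  c * placements ss′ (targets (pred c) d r) + (d * placements ss′ (targets c (pred d) r) + outer c d)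
    ≡⟨ cong₂ (λ x y → c * x + (d * y + outer c d)) (placements-merge ss (pred c) d r) (placements-merge ss c (pred d) r) ⟩
  c * G (pred c + d) + (d * G (c + pred d) + outer c d)
    ≡⟨ sym (+-assoc (c * G (pred c + d)) _ _) ⟩
  c * G (pred c + d) + d * G (c + pred d) + outer c d
    ≡⟨ cong₂ _+_ (add c d) (pick-cong same r) ⟩
  (c + d) * G (pred (c + d)) + outer (c + d) 0
    ≡⟨ sym (pick-targets _ (c + d) 0 r) ⟩
  placements (2 + s ∷ ss′) (targets (c + d) 0 r) ∎
  where
  open ≡-Reasoning
  ss′ = map (2 +_) ss

  G : ℕ → ℕ
  G u = placements ss′ (targets u 0 r)

  outer : ℕ → ℕ → ℕ
  outer c d = pick (λ t q → if t ≡ᵇ s then 0 else placements ss′ (targets c d q)) r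

  same : ∀ t q → (if t ≡ᵇ s then 0 else placements ss′ (targets c d q))
               ≡ (if t ≡ᵇ s then 0 else placements ss′ (targets (c + d) 0 q))
  same t q = cong (if t ≡ᵇ s then 0 else_) (placements-merge ss c d q)

  factor : ∀ c d g → suc c * g + suc d * g ≡ (suc c + suc d) * g
  factor = solve-∀

  add : ∀ c d → c * G (pred c + d) + d * G (c + pred d) ≡ (c + d) * G (pred (c + d))
  -- Where its factor is nonzero, each argument of `G` equals `pred (c + d)`; the case split
  -- isolates the zero factors.
  add zero    d       = refl
  add (suc c) zero    = trans (+-identityʳ _) (cong (_* G (c + 0)) (sym (+-identityʳ (suc c))))
  add (suc c) (suc d) =
    trans (cong (λ u → suc c * G (c + suc d) + suc d * G u) (sym (+-suc c d))) (factor c d (G (c + suc d)))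

∸-+-interchange : ∀ {a b i j} → i ≤ a → j ≤ b → (a ∸ i) + (b ∸ j) ≡ (a + b) ∸ (i + j)
∸-+-interchange {a} z≤n j≤b = sym (+-∸-assoc a j≤b)
∸-+-interchange (s≤s i≤a) j≤b = ∸-+-interchange i≤a j≤b

-- This is `W(n)`: `n` inner sources go to outer targets, then the outer sources are placed on what
-- is left. The same `n` counts the free inner targets, all given label 0.
completions : List ℕ → ℕ → ℕ
completions r n = pickAny^ n (λ s → placements (map (2 +_) r) (targets n 0 s)) r

-- Sources of label 0 use up targets of label 1 and conversely, so the two expansions do not
-- interfere.
placements-rook : ∀ a b r → placements (targets a b r) (targets a b r) ≡
  rook a b (λ i → rook b a (λ j → completions r ((a + b) ∸ (i + j))))
placements-rook a b r = begin
  placements (replicate a 0 ++ ss₁) (targets a b r)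
    ≡⟨ rook-expansion (λ a′ d s → placements (replicate a′ 0 ++ ss₁) (targets a d s))
         (λ a′ → placements-0∷ (replicate a′ 0 ++ ss₁) a) a b r ⟩
  rook a b (λ i → pickAny^ (a ∸ i) (λ s → placements ss₁ (targets a (b ∸ i) s)) r)
    ≡⟨ rook-cong a b (λ i i≤a i≤b → inner i i≤a i≤b) ⟩
  rook a b (λ i → rook b a (λ j → completions r ((a + b) ∸ (i + j)))) ∎
  where
  open ≡-Reasoning
  ss₂ = map (2 +_) r
  ss₁ = replicate b 1 ++ ss₂

  count : ∀ i j → i ≤ a → i ≤ b → j ≤ b → j ≤ a →
    pickAny^ (a ∸ i) (pickAny^ (b ∸ j) (λ s → placements ss₂ (targets (a ∸ j) (b ∸ i) s))) r
      ≡ completions r ((a + b) ∸ (i + j))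
  count i j i≤a i≤b j≤b j≤a = begin
    pickAny^ (a ∸ i) (pickAny^ (b ∸ j) (λ s → placements ss₂ (targets (a ∸ j) (b ∸ i) s))) r
      ≡⟨ cong (λ h → h r) (pickAny^-+ (a ∸ i) (b ∸ j) _) ⟩
    pickAny^ ((a ∸ i) + (b ∸ j)) (λ s → placements ss₂ (targets (a ∸ j) (b ∸ i) s)) r
      ≡⟨ pickAny^-cong ((a ∸ i) + (b ∸ j)) (placements-merge r (a ∸ j) (b ∸ i)) r ⟩
    pickAny^ ((a ∸ i) + (b ∸ j)) (λ s → placements ss₂ (targets ((a ∸ j) + (b ∸ i)) 0 s)) r
      -- Each of the `i + j` inner pairs uses one inner source and one inner target, so equally many
      -- of both remain.
      ≡⟨ cong₂ (λ n u → pickAny^ n (λ s → placements ss₂ (targets u 0 s)) r)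
           (∸-+-interchange i≤a j≤b)
           (trans (∸-+-interchange j≤a i≤b) (cong ((a + b) ∸_) (+-comm j i))) ⟩
    completions r ((a + b) ∸ (i + j)) ∎

  inner : ∀ i → i ≤ a → i ≤ b →
    pickAny^ (a ∸ i) (λ s → placements ss₁ (targets a (b ∸ i) s)) r
      ≡ rook b a (λ j → completions r ((a + b) ∸ (i + j)))
  inner i i≤a i≤b = begin
    pickAny^ (a ∸ i) (λ s → placements ss₁ (targets a (b ∸ i) s)) r
      ≡⟨ pickAny^-cong (a ∸ i)
           (rook-expansion (λ b′ c s → placements (replicate b′ 1 ++ ss₂) (targets c (b ∸ i) s))
             (λ b′ c → placements-1∷ (replicate b′ 1 ++ ss₂) c (b ∸ i)) b a) r ⟩
    pickAny^ (a ∸ i) (λ s → rook b a (λ j →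
        pickAny^ (b ∸ j) (λ s → placements ss₂ (targets (a ∸ j) (b ∸ i) s)) s)) r
      ≡⟨ pickAny^-rook (a ∸ i) b a _ r ⟩
    rook b a (λ j → pickAny^ (a ∸ i) (pickAny^ (b ∸ j) (λ s → placements ss₂ (targets (a ∸ j) (b ∸ i) s))) r)
      ≡⟨ rook-cong b a (λ j → count i j i≤a i≤b) ⟩
    rook b a (λ j → completions r ((a + b) ∸ (i + j))) ∎

-- The formula for `P` and the inequality

labels-targets : ∀ a b ts → labels (a ∷ b ∷ ts) ≡ targets a b (labels ts)
-- The labels of `ts` start at 2 here; two unit shifts relate them to labels starting at 0.
labels-targets a b ts = cong (λ ls → replicate a 0 ++ (replicate b 1 ++ ls))
  (trans (labelsFrom-suc (a ∷ b ∷ ts) ts 1 ts) (trans (cong (map suc) (labelsFrom-suc ts ts 0 ts)) (sym (map-∘ _))))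

P-rook : ∀ a b ts → P (a ∷ b ∷ ts) ≡
  rook a b (λ i → rook b a (λ j → completions (labels ts) ((a + b) ∸ (i + j))))
P-rook a b ts = trans (P≡placements (a ∷ b ∷ ts))
  (trans (cong (λ ls → placements ls ls) (labels-targets a b ts)) (placements-rook a b (labels ts)))

theorem4p1 : (t₁ t₂ : ℕ) (ts : List ℕ) →
    t₁ ≥ t₂ → 1 ≤ t₂ →
    P (suc t₁ ∷ t₂ ∸ 1 ∷ ts) ≤ P (t₁ ∷ t₂ ∷ ts)
theorem4p1 (suc a) (suc b) ts (s≤s b≤a) _ = begin
  P (2 + a ∷ b ∷ ts)
    ≡⟨ P-rook (2 + a) b ts ⟩
  rook (2 + a) b (λ i → rook b (2 + a) (λ j → W (2 + a + b ∸ (i + j))))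
    -- Moving one element preserves the total size, so both sides share the weight `ψ`.
    ≡⟨ cong (λ m → rook (2 + a) b (λ i → rook b (2 + a) (λ j → W (m ∸ (i + j))))) (sym (+-suc (suc a) b)) ⟩
  rook (2 + a) b (λ i → rook b (2 + a) (ψ i))
    -- The two matching sums are rebalanced in turn: the inner one under monotonicity, then the
    -- outer one.
    ≤⟨ rook-mono (2 + a) b (λ i → balance (ψ i)) ⟩
  rook (2 + a) b (λ i → rook (suc b) (suc a) (ψ i))
    ≤⟨ rook-balance _ b≤1+a ⟩
  rook (suc a) (suc b) (λ i → rook (suc b) (suc a) (ψ i))
    ≡⟨ sym (P-rook (suc a) (suc b) ts) ⟩
  P (suc a ∷ suc b ∷ ts) ∎
  where
  open ≤-Reasoning
  W = completions (labels ts)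

  ψ : ℕ → ℕ → ℕ
  ψ i j = W (suc a + suc b ∸ (i + j))

  b≤1+a : b ≤ suc a
  b≤1+a = m≤n⇒m≤1+n b≤a

  balance : ∀ χ → rook b (2 + a) χ ≤ rook (suc b) (suc a) χ
  balance χ = begin
    rook b (2 + a) χ       ≡⟨ rook-comm b (2 + a) χ ⟩
    rook (2 + a) b χ       ≤⟨ rook-balance χ b≤1+a ⟩
    rook (suc a) (suc b) χ ≡⟨ rook-comm (suc a) (suc b) χ ⟩
    rook (suc b) (suc a) χ ∎
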